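{- Let $(\mathbf{A}_n)_{n\geq 1}$ be a sequence of sets of query games. Suppose there is a constant $\alpha>0$ such that every game in $\mathbf{A}_1$ has a simple reduction of length at most $\alpha$ to the trivial game $\emptyset$, and, for all $n\geq 2$, every game in $\mathbf{A}_n$ has a simple reduction of length at most $\alpha\cdot n$ to the set $\mathbf{A}_{\lceil n/2\rceil}+\mathbf{A}_{\lfloor n/2\rfloor}$. Then there is an absolute constant $C$ (independent of $\alpha$, $n$ and the sequence) such that for every $n\geq 1$, every game in $\mathbf{A}_n$ has a solution of length at most $C\alpha n$; i.e. $\mathbf{A}_n\xrightarrow{\mathcal{O}(\alpha n)}\emptyset$.
   Context: A query game is a pair $A=(Q,\mathcal{F})$ where $Q$ is a set containing a distinguished zero-query $0$ and $\mathcal{F}$ is a nonempty set of functions (codewords) $f:Q\to\mathbb{Z}$ with $f(0)=0$ for all $f\in\mathcal{F}$; games differing only by a relabelling of queries are identified. A strategy of length $T$ for $A$ is a sequence of queries $q(1),\dots,q(T)\in Q$ where $q(t)$ may depend on the answers $f(q(1)),\dots,f(q(t-1))$ for the hidden codeword $f$; it is a solution if for every $f\in\mathcal{F}$ and every $f'\in\mathcal{F}\setminus\{f\}$ there is $t$ with $f'(q(t))\neq f(q(t))$. The trivial game $\emptyset$ has only the zero-query and only the codeword $0\mapsto 0$. For games $A=(Q_A,\mathcal{F}_A)$, $B=(Q_B,\mathcal{F}_B)$, the sum $A+B$ is the game $(Q_A\times Q_B,\mathcal{F}_A\times\mathcal{F}_B)$, writing pairs as $q_A+q_B$ and $f_A+f_B$,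 with $(f_A+f_B)(q_A+q_B)=f_A(q_A)+f_B(q_B)$ (zero-query $0+0$); for sets of games, $\mathbf{A}+\mathbf{B}=\{A+B: A\in\mathbf{A},B\in\mathbf{B}\}$. A reduction of length $T$ from a game $A$ to a set of games $\mathbf{B}$ is a strategy $(q(t))_{t=1}^T$ for $A$ such that for every answer sequence $\mathbf{a}=(a_1,\dots,a_T)$ there exist a game $B=(Q_B,\mathcal{F}_B)\in\mathbf{B}$ and maps $\varphi:Q_B\to Q_A$, $\Phi:\mathcal{F}_B\to\mathcal{F}_A$, all depending only on $\mathbf{a}$, such that for every $f'\in\mathcal{F}_A$ consistent with $\mathbf{a}$ (i.e. for which the strategy produces the answers $\mathbf{a}$) one has $f'\circ\varphi\in\mathcal{F}_B$ and $\Phi(f'\circ\varphi)=f'$. A reduction to $\emptyset$ means a reduction to $\{\emptyset\}$. A reduction is simple if $f(q(t))\in\{0,1\}$ for all $f\in\mathcal{F}_A$ and all $t$. -}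

module Defs where

open import Data.Nat as ℕ using (ℕ; zero; suc)
open import Data.Integer as ℤ using (ℤ; 0ℤ; 1ℤ)
open import Data.Integer.Properties using (+-identityʳ; +-comm)
open import Data.Rational as ℚ using (ℚ)
open import Data.Vec using (Vec; []; _∷_)
open import Data.Vec.Relation.Unary.All using (All)
open import Data.Product using (Σ; Σ-syntax; ∃; ∃-syntax; _×_; _,_)
open import Data.Sum using (_⊎_)
open import Data.Unit using (⊤; tt)
open import Function using (_∘_)
open import Relation.Binary.PropositionalEquality

-- Query games
--
-- A game has a query type Q with a distinguished zero query, and a set of
-- codewords F, a subset of (Q → ℤ).  Subsets of a function space are
-- modelled as predicates that respect pointwise equality (functions are
-- identified when pointwise equal, as in set theory).

PtEq : {Q : Set} → (Q → ℤ) → (Q → ℤ) → Set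
PtEq f g = ∀ q → f q ≡ g q

record Game : Set₁ where
  field
    Q        : Set
    zeroQ    : Q
    F        : (Q → ℤ) → Set
    F-resp   : ∀ {f g} → PtEq f g → F f → F g
    nonempty : ∃[ f ] F f
    F-zero   : ∀ f → F f → f zeroQ ≡ 0ℤ

open Game public

GameSet : Set₂
GameSet = Game → Set₁

trivialGame : Game
trivialGame = record
  { Q = ⊤ ; zeroQ = tt ; F = λ f → f tt ≡ 0ℤ
  ; F-resp = λ {f} {g} p e → trans (sym (p tt)) e
  ; nonempty = (λ _ → 0ℤ) , refl
  ; F-zero = λ f e → e }

trivialSet : GameSet
trivialSet G = G ≡ trivialGame

_⊕_ : Game → Game → Game
A ⊕ B = record
  { Q = Q A × Q B
  ; zeroQ = zeroQ A , zeroQ B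
  ; F = λ h → Σ[ fa ∈ (Q A → ℤ) ] Σ[ fb ∈ (Q B → ℤ) ]
          F A fa × F B fb × (∀ qa qb → h (qa , qb) ≡ fa qa ℤ.+ fb qb)
  ; F-resp = λ { p (fa , fb , ia , ib , e) →
        fa , fb , ia , ib , λ qa qb → trans (sym (p (qa , qb))) (e qa qb) }
  ; nonempty = let (fa , ia) = nonempty A ; (fb , ib) = nonempty B in
      (λ { (qa , qb) → fa qa ℤ.+ fb qb }) , fa , fb , ia , ib , λ _ _ → refl
  ; F-zero = λ { h (fa , fb , ia , ib , e) →
        trans (e (zeroQ A) (zeroQ B))
          (trans (cong₂ ℤ._+_ (F-zero A fa ia) (F-zero B fb ib)) refl) }
  }

_⊕ˢ_ : GameSet → GameSet → GameSet
(𝐀 ⊕ˢ 𝐁) G = Σ[ A ∈ Game ] Σ[ B ∈ Game ] 𝐀 A × 𝐁 B × (G ≡ A ⊕ B)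

-- Adaptive strategies of length T, as decision trees: the next query may
-- depend on all previous answers.

data Strategy (Q : Set) : ℕ → Set where
  done : Strategy Q zero
  ask  : ∀ {n} → Q → (ℤ → Strategy Q n) → Strategy Q (suc n)

answers : ∀ {Q T} → Strategy Q T → (Q → ℤ) → Vec ℤ T
answers done        f = []
answers (ask q k)   f = f q ∷ answers (k (f q)) f

IsSolution : (A : Game) {T : ℕ} → Strategy (Q A) T → Set
IsSolution A s = ∀ f f' → F A f → F A f' → answers s f ≡ answers s f' → PtEq f f'

IsSimple : (A : Game) {T : ℕ} → Strategy (Q A) T → Set
IsSimple A s = ∀ f → F A f → All (λ a → a ≡ 0ℤ ⊎ a ≡ 1ℤ) (answers s f)

IsReduction : (A : Game) {T : ℕ} → Strategy (Q A) T → GameSet → Set₁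
IsReduction A {T} s 𝐁 =
  (𝐚 : Vec ℤ T) →
  Σ[ B ∈ Game ] 𝐁 B ×
  Σ[ φ ∈ (Q B → Q A) ]
  Σ[ Φ ∈ ((g : Q B → ℤ) → F B g → (Q A → ℤ)) ]
    (∀ g g' (p : F B g) (p' : F B g') → PtEq g g' → PtEq (Φ g p) (Φ g' p'))
  × (∀ f' → F A f' → answers s f' ≡ 𝐚 →
       Σ[ p ∈ F B (f' ∘ φ) ] PtEq (Φ (f' ∘ φ) p) f')

SimpleReducesWithin : Game → ℚ → GameSet → Set₁
SimpleReducesWithin A β 𝐁 =
  Σ[ T ∈ ℕ ] (ℤ.+ T ℚ./ 1 ℚ.≤ β) ×
  Σ[ s ∈ Strategy (Q A) T ] IsSimple A s × IsReduction A s 𝐁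

SolvableWithin : Game → ℚ → Set
SolvableWithin A β =
  Σ[ T ∈ ℕ ] (ℤ.+ T ℚ./ 1 ℚ.≤ β) × Σ[ s ∈ Strategy (Q A) T ] IsSolution A s

{-# OPTIONS --safe #-}

-- If d is a bit, the queries a + b, a + c and b + c + d reveal a, b, c and d: the sum of the three
-- answers is 2(a + b + c) + d.  Hence in 3T queries one can run any three reductions of length T
-- and, for free, a simple reduction of length T on a fourth summand.
--
-- Two halvings reduce a game of size 4^(m+1) to four games of size 4^m.  Call a game preloaded if
-- this has been done and three of the four are preloaded in turn; the geometric series with ratio
-- 3/4 shows that preloading is a simple reduction of length at most 8α4^m.  If preloaded games of
-- size 4^m are solved in 8α4^m queries, then a preloaded game of size 4^(m+1) is solved in
-- 4 · 8α4^m: its three preloaded parts are solved in parallel while the fourth part is being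
-- preloaded, and then the fourth is solved alone.
module Submission where

open import Defs
open import Data.Nat using (ℕ; _≤_; ⌈_/2⌉; ⌊_/2⌋)
open import Data.Integer using (+_)
open import Data.Rational using (ℚ; Positive; _*_; _/_)
open import Data.Product using (∃-syntax)

open import Data.Nat as ℕ using (zero; suc; z≤n; s≤s; _∸_)
open import Data.Nat.Coprimality using (Coprime)
import Data.Nat.DivMod as ℕ
import Data.Nat.Properties as ℕ
import Data.Nat.Tactic.RingSolver as ℕ-Solver
open import Data.Integer as ℤ using (ℤ; 0ℤ; 1ℤ; _-_)
import Data.Integer.DivMod as ℤ
import Data.Integer.Properties as ℤ
import Data.Integer.Tactic.RingSolver as ℤ-Solver
import Data.Rational as ℚ
open import Data.Rational using (mkℚ; toℚᵘ)
import Data.Rational.Properties as ℚ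
import Data.Rational.Unnormalised as ℚᵘ
import Data.Rational.Unnormalised.Properties as ℚᵘ
open import Data.Product using (_×_; _,_; proj₁; proj₂)
open import Data.Sum using (_⊎_; inj₁; inj₂)
open import Data.Unit using (⊤; tt)
open import Data.Vec using (Vec; []; _∷_; _++_; splitAt)
open import Data.Vec.Properties using (++-injectiveˡ; ++-injectiveʳ)
open import Data.Vec.Relation.Unary.All as All using (All; []; _∷_)
open import Data.Vec.Relation.Unary.All.Properties using (++⁺)
open import Function using (_∘_)
open import Relation.Binary.PropositionalEquality
open import Relation.Nullary using (yes; no)

-- Adaptive strategies: concatenation, relabelling of queries, repetition.

bind : ∀ {X T T'} → Strategy X T → (Vec ℤ T → Strategy X T') → Strategy X (T ℕ.+ T')
bind done      k = k []
bind (ask q c) k = ask q λ a → bind (c a) (k ∘ (a ∷_))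

bind-answers : ∀ {X T T'} (s : Strategy X T) (k : Vec ℤ T → Strategy X T') f →
  answers (bind s k) f ≡ answers s f ++ answers (k (answers s f)) f
bind-answers done      k f = refl
bind-answers (ask q c) k f = cong (f q ∷_) (bind-answers (c (f q)) _ f)

-- The prefixes have equal length, so the answer vector splits uniquely; the continuation becomes
-- `k 𝐚`, which no longer depends on `f`.
bind-consistent : ∀ {X T T'} (s : Strategy X T) (k : Vec ℤ T → Strategy X T') f {𝐚 𝐛} →
  answers (bind s k) f ≡ 𝐚 ++ 𝐛 → answers s f ≡ 𝐚 × answers (k 𝐚) f ≡ 𝐛
bind-consistent s k f {𝐚} e with trans (sym (bind-answers s k f)) e
... | e' with ++-injectiveˡ (answers s f) 𝐚 e' | ++-injectiveʳ (answers s f) 𝐚 e'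
... | refl | e'' = refl , e''

mapQ : ∀ {X Y T} → (X → Y) → Strategy X T → Strategy Y T
mapQ φ done      = done
mapQ φ (ask q k) = ask (φ q) (mapQ φ ∘ k)

mapQ-answers : ∀ {X Y T} (φ : X → Y) (s : Strategy X T) f →
  answers (mapQ φ s) f ≡ answers s (f ∘ φ)
mapQ-answers φ done      f = refl
mapQ-answers φ (ask q k) f = cong (f (φ q) ∷_) (mapQ-answers φ (k (f (φ q))) f)

answers-cong : ∀ {X T} (s : Strategy X T) {f g} → PtEq f g → answers s f ≡ answers s g
answers-cong done          e = refl
answers-cong (ask q k) {f} e rewrite e q = cong (_ ∷_) (answers-cong (k _) e)

repeat : ∀ {X} → X → ∀ T → Strategy X T
repeat q zero    = done
repeat q (suc T) = ask q λ _ → repeat q T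

-- Reductions with restricted answers, and their composition.

Bit : ℤ → Set
Bit a = a ≡ 0ℤ ⊎ a ≡ 1ℤ

AnyInt : ℤ → Set
AnyInt _ = ⊤

-- The decoding map Φ of a reduction is replaced by the injectivity of f ↦ f ∘ φ on the codewords
-- satisfying K.  Unlike IsReduction, whose Φ may leave F A on inconsistent codewords, this composes.
record Outcome (A : Game) (K : (Q A → ℤ) → Set) (𝐁 : GameSet) : Set₁ where
  field
    target    : Game
    target∈   : 𝐁 target
    embed     : Q target → Q A
    restrict  : ∀ f → F A f → K f → F target (f ∘ embed)
    determine : ∀ f g → F A f → F A g → K f → K g →
                PtEq (f ∘ embed) (g ∘ embed) → PtEq f g

open Outcome

-- The predicate `V` is `Bit` for simple reductions and `AnyInt` for arbitrary ones, so that
-- composition, padding and sums are built once for both.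
record Reduction (V : ℤ → Set) (A : Game) (T : ℕ) (𝐁 : GameSet) : Set₁ where
  field
    strategy : Strategy (Q A) T
    valid    : ∀ f → F A f → All V (answers strategy f)
    outcome  : (𝐚 : Vec ℤ T) → Outcome A (λ f → answers strategy f ≡ 𝐚) 𝐁

open Reduction

weakenK : ∀ {A K L 𝐁} → (∀ f → F A f → L f → K f) → Outcome A K 𝐁 → Outcome A L 𝐁
weakenK w o = record
  { target = target o ; target∈ = target∈ o ; embed = embed o
  ; restrict  = λ f i l → restrict o f i (w f i l)
  ; determine = λ f g i j l l' → determine o f g i j (w f i l) (w g j l') }

weaken : ∀ {V A T 𝐁 𝐁'} → (∀ B → 𝐁 B → 𝐁' B) → Reduction V A T 𝐁 → Reduction V A T 𝐁'
weaken w r = record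
  { strategy = strategy r ; valid = valid r
  ; outcome = λ 𝐚 → let o = outcome r 𝐚 in record
      { target = target o ; target∈ = w _ (target∈ o) ; embed = embed o
      ; restrict = restrict o ; determine = determine o } }

forgetV : ∀ {V A T 𝐁} → Reduction V A T 𝐁 → Reduction AnyInt A T 𝐁
forgetV r = record
  { strategy = strategy r ; valid = λ _ _ → All.universal (λ _ → tt) _ ; outcome = outcome r }

infixr 4 _⨟_

-- The first answers fix an intermediate game before the second stage starts, and consistent
-- codewords restrict to codewords of it. Hence the second strategy can be run through `embed`, and
-- equality on the final target lifts back in two steps.
_⨟_ : ∀ {V A T T' 𝐁 𝐂} → Reduction V A T 𝐁 → (∀ B → 𝐁 B → Reduction V B T' 𝐂) →
  Reduction V A (T ℕ.+ T') 𝐂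
_⨟_ {V} {A} {T} {T'} {𝐁} {𝐂} r next = record
  { strategy = bind (strategy r) second ; valid = both-valid ; outcome = both-outcome }
  where
  next' : ∀ 𝐚 → Reduction V (target (outcome r 𝐚)) T' 𝐂
  next' 𝐚 = next _ (target∈ (outcome r 𝐚))

  second : Vec ℤ T → Strategy (Q A) T'
  second 𝐚 = mapQ (embed (outcome r 𝐚)) (strategy (next' 𝐚))

  both-valid : ∀ f → F A f → All V (answers (bind (strategy r) second) f)
  both-valid f i
    rewrite bind-answers (strategy r) second f
          | mapQ-answers (embed (outcome r (answers (strategy r) f)))
                         (strategy (next' (answers (strategy r) f))) f
    -- Every codeword is consistent with its own answers, hence `refl`.
    = ++⁺ (valid r f i) (valid (next' _) _ (restrict (outcome r _) f i refl))

  both-outcome : ∀ 𝐚 → Outcome A (λ f → answers (bind (strategy r) second) f ≡ 𝐚) 𝐂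
  both-outcome 𝐚 with splitAt T 𝐚
  ... | 𝐚₁ , 𝐚₂ , refl = record
    { target = target o₂ ; target∈ = target∈ o₂ ; embed = embed o₁ ∘ embed o₂
    ; restrict = λ f i e → restrict o₂ _ (restrict o₁ f i (first f e)) (then f e)
    ; determine = λ f g i j e e' p →
        determine o₁ f g i j (first f e) (first g e')
          (determine o₂ _ _ (restrict o₁ f i (first f e)) (restrict o₁ g j (first g e'))
            (then f e) (then g e') p) }
    where
    o₁ = outcome r 𝐚₁
    o₂ = outcome (next' 𝐚₁) 𝐚₂
    first : ∀ f → answers (bind (strategy r) second) f ≡ 𝐚₁ ++ 𝐚₂ → answers (strategy r) f ≡ 𝐚₁
    first f e = proj₁ (bind-consistent (strategy r) second f e)
    then : ∀ f → answers (bind (strategy r) second) f ≡ 𝐚₁ ++ 𝐚₂ →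
      answers (strategy (next' 𝐚₁)) (f ∘ embed o₁) ≡ 𝐚₂
    then f e = trans (sym (mapQ-answers (embed o₁) (strategy (next' 𝐚₁)) f))
                     (proj₂ (bind-consistent (strategy r) second f e))

-- Padding with zero queries.

repeat-zeroQ-valid : ∀ {V : ℤ → Set} A → V 0ℤ → ∀ T f → F A f →
  All V (answers (repeat (zeroQ A) T) f)
repeat-zeroQ-valid     A v zero    f i = []
repeat-zeroQ-valid {V} A v (suc T) f i =
  subst V (sym (F-zero A f i)) v ∷ repeat-zeroQ-valid A v T f i

wait : ∀ {V A} {𝐁 : GameSet} → V 0ℤ → ∀ T → 𝐁 A → Reduction V A T 𝐁
wait {A = A} v T A∈ = record
  { strategy = repeat (zeroQ A) T
  ; valid    = repeat-zeroQ-valid A v T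
  ; outcome  = λ _ → record
      { target = A ; target∈ = A∈ ; embed = λ q → q
      ; restrict = λ _ i _ → i ; determine = λ _ _ _ _ _ _ e → e } }

-- Strategies run in parallel must have exactly equal lengths, so upper bounds on lengths are turned
-- into equalities.
pad : ∀ {V A T T' 𝐁} → V 0ℤ → T ≤ T' → Reduction V A T 𝐁 → Reduction V A T' 𝐁
pad {T = T} {T'} {𝐁} v T≤T' r =
  subst (λ n → Reduction _ _ n 𝐁) (ℕ.m+[n∸m]≡n T≤T') (r ⨟ λ B B∈ → wait v (T' ∸ T) B∈)

unqueried : ∀ {V A 𝐁} → Outcome A (λ _ → ⊤) 𝐁 → Reduction V A 0 𝐁
unqueried o = record
  { strategy = done ; valid = λ _ _ → []
  ; outcome = λ _ → weakenK (λ _ _ _ → tt) o }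

-- Sums of reductions.

Splits : ∀ {X Y : Set} → (X × Y → ℤ) → (X → ℤ) → (Y → ℤ) → Set
Splits h f g = ∀ x y → h (x , y) ≡ f x ℤ.+ g y

+-zeroˡ : ∀ y {x} → x ≡ 0ℤ → x ℤ.+ y ≡ y
+-zeroˡ y e = trans (cong (ℤ._+ y) e) (ℤ.+-identityˡ y)

+-zeroʳ : ∀ y {x} → x ≡ 0ℤ → y ℤ.+ x ≡ y
+-zeroʳ y e = trans (cong (λ x → y ℤ.+ x) e) (ℤ.+-identityʳ y)

-- Codewords vanish at the zero query, so each component can be read off from the sum; a
-- decomposition is therefore unique up to pointwise equality.
splits-sndˡ : ∀ A B {h : Q A × Q B → ℤ} {f g} → F A f → Splits h f g →
  PtEq (λ y → h (zeroQ A , y)) g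
splits-sndˡ A B {f = f} {g} i e y = trans (e (zeroQ A) y) (+-zeroˡ (g y) (F-zero A f i))

splits-fstʳ : ∀ A B {h : Q A × Q B → ℤ} {f g} → F B g → Splits h f g →
  PtEq (λ x → h (x , zeroQ B)) f
splits-fstʳ A B {f = f} {g} i e x = trans (e x (zeroQ B)) (+-zeroʳ (f x) (F-zero B g i))

-- All decompositions of `h` are covered, so that the condition applies to whichever one a
-- membership proof supplies.
Components : ∀ A B → ((Q A → ℤ) → Set) → ((Q B → ℤ) → Set) → (Q (A ⊕ B) → ℤ) → Set
Components A B K L h = ∀ f g → F A f → F B g → Splits h f g → K f × L g

-- Setting one coordinate of the target to zero separates an equality of restricted sums into
-- equalities of the restricted components, and each given outcome then identifies its own
-- component.
outcome-⊕ : ∀ {A B K L 𝐀 𝐁} → Outcome A K 𝐀 → Outcome B L 𝐁 →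
  Outcome (A ⊕ B) (Components A B K L) (𝐀 ⊕ˢ 𝐁)
outcome-⊕ {A} {B} {K} {L} o o' = record
  { target = A' ⊕ B'
  ; target∈ = A' , B' , target∈ o , target∈ o' , refl
  ; embed = λ (x , y) → embed o x , embed o' y
  ; restrict = λ { h (f , g , i , j , e) c → let k , l = c f g i j e in
      f ∘ embed o , g ∘ embed o' , restrict o f i k , restrict o' g j l , λ _ _ → e _ _ }
  ; determine = λ { h h' (f , g , i , j , e) (f' , g' , i' , j' , e') c c' p (x , y) →
      let k , l   = c f g i j e
          k' , l' = c' f' g' i' j' e'
          f≈f' x  = trans (sym (splits-fstʳ A' B' {f = f ∘ embed o} (restrict o' g j l)
                                 (λ x y → e (embed o x) (embed o' y)) x))
                   (trans (p (x , zeroQ B'))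
                          (splits-fstʳ A' B' {f = f' ∘ embed o} (restrict o' g' j' l')
                                 (λ x y → e' (embed o x) (embed o' y)) x))
          g≈g' y  = trans (sym (splits-sndˡ A' B' {g = g ∘ embed o'} (restrict o f i k)
                                 (λ x y → e (embed o x) (embed o' y)) y))
                   (trans (p (zeroQ A' , y))
                          (splits-sndˡ A' B' {g = g' ∘ embed o'} (restrict o f' i' k')
                                 (λ x y → e' (embed o x) (embed o' y)) y))
      in trans (e x y) (trans (cong₂ ℤ._+_ (determine o f f' i i' k k' f≈f' x)
                                           (determine o' g g' j j' l l' g≈g' y))
                              (sym (e' x y))) } }
  where
  A' = target o
  B' = target o'

infixr 5 _⊞_

-- A query that is zero in one coordinate sees only the other summand. Each answer thus belongs to
-- one of the two reductions, and simplicity is preserved.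
_⊞_ : ∀ {V A B T T' 𝐀 𝐁} → Reduction V A T 𝐀 → Reduction V B T' 𝐁 →
  Reduction V (A ⊕ B) (T ℕ.+ T') (𝐀 ⊕ˢ 𝐁)
_⊞_ {V} {A} {B} {T} {T'} {𝐀} {𝐁} r r' = record
  { strategy = bind left right ; valid = both-valid ; outcome = both-outcome }
  where
  left : Strategy (Q A × Q B) T
  left = mapQ (_, zeroQ B) (strategy r)
  right : Vec ℤ T → Strategy (Q A × Q B) T'
  right _ = mapQ (zeroQ A ,_) (strategy r')

  left-answers : ∀ {h f g} → F B g → Splits h f g → answers left h ≡ answers (strategy r) f
  left-answers ib e = trans (mapQ-answers _ (strategy r) _)
                            (answers-cong (strategy r) (splits-fstʳ A B ib e))

  right-answers : ∀ {h f g 𝐚} → F A f → Splits h f g →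
    answers (right 𝐚) h ≡ answers (strategy r') g
  right-answers ia e = trans (mapQ-answers _ (strategy r') _)
                             (answers-cong (strategy r') (splits-sndˡ A B ia e))

  both-valid : ∀ h → F (A ⊕ B) h → All V (answers (bind left right) h)
  both-valid h (fa , fb , ia , ib , e) = subst (All V)
    (sym (trans (bind-answers left right h)
                (cong₂ _++_ (left-answers ib e) (right-answers {𝐚 = answers left h} ia e))))
    (++⁺ (valid r fa ia) (valid r' fb ib))

  both-outcome : ∀ 𝐚 → Outcome (A ⊕ B) (λ h → answers (bind left right) h ≡ 𝐚) (𝐀 ⊕ˢ 𝐁)
  both-outcome 𝐚 with splitAt T 𝐚
  ... | 𝐚₁ , 𝐚₂ , refl = weakenK
    (λ h _ eq fa fb ia ib e → let eq₁ , eq₂ = bind-consistent left right h eq in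
       trans (sym (left-answers ib e)) eq₁ , trans (sym (right-answers {𝐚 = 𝐚₁} ia e)) eq₂)
    (outcome-⊕ (outcome r 𝐚₁) (outcome r' 𝐚₂))

-- Decoding three integers and a bit from three sums.

half : ℤ → ℤ
half x = x ℤ./ℕ 2

-- Both `half x` and `t` are integers k with 2k ≤ x < 2(k + 1), for `t` because `d` is 0 or 1;
-- comparing these bounds crosswise gives both inequalities.
half-bit : ∀ t {d} → Bit d → half (t ℤ.+ t ℤ.+ d) ≡ t
half-bit t {d} bit = ℤ.≤-antisym (lower t _ q≤) (lower _ t ≤q)
  where
  x = t ℤ.+ t ℤ.+ d

  0≤d : ∀ {d} → Bit d → 0ℤ ℤ.≤ d
  0≤d (inj₁ refl) = ℤ.≤-refl
  0≤d (inj₂ refl) = ℤ.+≤+ z≤n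

  d<2 : ∀ {d} → Bit d → d ℤ.< + 2
  d<2 (inj₁ refl) = ℤ.+<+ (s≤s z≤n)
  d<2 (inj₂ refl) = ℤ.+<+ (s≤s (s≤s z≤n))

  twice : ∀ t → t ℤ.* + 2 ≡ t ℤ.+ t ℤ.+ 0ℤ
  twice = ℤ-Solver.solve-∀

  twice-suc : ∀ t → (+ 1 ℤ.+ t) ℤ.* + 2 ≡ t ℤ.+ t ℤ.+ + 2
  twice-suc = ℤ-Solver.solve-∀

  lower : ∀ s t → t ℤ.* + 2 ℤ.< ℤ.suc s ℤ.* + 2 → t ℤ.≤ s
  lower s t lt = subst (t ℤ.≤_) (ℤ.pred-suc s)
    (ℤ.i<j⇒i≤pred[j] {t} {ℤ.suc s} (ℤ.*-cancelʳ-<-nonNeg {t} {ℤ.suc s} (+ 2) lt))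

  q≤ : half x ℤ.* + 2 ℤ.< ℤ.suc t ℤ.* + 2
  q≤ = ℤ.≤-<-trans (ℤ.[n/ℕd]*d≤n x 2)
    (subst (x ℤ.<_) (sym (twice-suc t)) (ℤ.+-monoʳ-< (t ℤ.+ t) (d<2 bit)))

  ≤q : t ℤ.* + 2 ℤ.< ℤ.suc (half x) ℤ.* + 2
  ≤q = ℤ.≤-<-trans (subst (ℤ._≤ x) (sym (twice t)) (ℤ.+-monoʳ-≤ (t ℤ.+ t) (0≤d bit)))
    (ℤ.n<s[n/ℕd]*d x 2)

-- Here u = a + b, v = a + c and w = b + c + d, so that ⌊(u + v + w) / 2⌋ = a + b + c.
decode₁ decode₂ decode₃ decode₄ : ℤ → ℤ → ℤ → ℤ
decode₁ u v w = u ℤ.+ v - half (u ℤ.+ v ℤ.+ w)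
decode₂ u v w = half (u ℤ.+ v ℤ.+ w) - v
decode₃ u v w = half (u ℤ.+ v ℤ.+ w) - u
decode₄ u v w = u ℤ.+ v ℤ.+ w - (half (u ℤ.+ v ℤ.+ w) ℤ.+ half (u ℤ.+ v ℤ.+ w))

module _ (a b c : ℤ) {d : ℤ} (bit : Bit d) where

  half-sum : half ((a ℤ.+ b) ℤ.+ (a ℤ.+ c) ℤ.+ (b ℤ.+ (c ℤ.+ d))) ≡ a ℤ.+ b ℤ.+ c
  half-sum = trans (cong half (regroup a b c d)) (half-bit (a ℤ.+ b ℤ.+ c) bit)
    where
    regroup : ∀ a b c d → (a ℤ.+ b) ℤ.+ (a ℤ.+ c) ℤ.+ (b ℤ.+ (c ℤ.+ d)) ≡
      (a ℤ.+ b ℤ.+ c) ℤ.+ (a ℤ.+ b ℤ.+ c) ℤ.+ d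
    regroup = ℤ-Solver.solve-∀

  decode₁-correct : decode₁ (a ℤ.+ b) (a ℤ.+ c) (b ℤ.+ (c ℤ.+ d)) ≡ a
  decode₁-correct rewrite half-sum = ring a b c
    where
    ring : ∀ a b c → (a ℤ.+ b) ℤ.+ (a ℤ.+ c) - (a ℤ.+ b ℤ.+ c) ≡ a
    ring = ℤ-Solver.solve-∀

  decode₂-correct : decode₂ (a ℤ.+ b) (a ℤ.+ c) (b ℤ.+ (c ℤ.+ d)) ≡ b
  decode₂-correct rewrite half-sum = ring a b c
    where
    ring : ∀ a b c → (a ℤ.+ b ℤ.+ c) - (a ℤ.+ c) ≡ b
    ring = ℤ-Solver.solve-∀

  decode₃-correct : decode₃ (a ℤ.+ b) (a ℤ.+ c) (b ℤ.+ (c ℤ.+ d)) ≡ c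
  decode₃-correct rewrite half-sum = ring a b c
    where
    ring : ∀ a b c → (a ℤ.+ b ℤ.+ c) - (a ℤ.+ b) ≡ c
    ring = ℤ-Solver.solve-∀

  decode₄-correct : decode₄ (a ℤ.+ b) (a ℤ.+ c) (b ℤ.+ (c ℤ.+ d)) ≡ d
  decode₄-correct rewrite half-sum = ring a b c d
    where
    ring : ∀ a b c d → (a ℤ.+ b) ℤ.+ (a ℤ.+ c) ℤ.+ (b ℤ.+ (c ℤ.+ d))
      - ((a ℤ.+ b ℤ.+ c) ℤ.+ (a ℤ.+ b ℤ.+ c)) ≡ d
    ring = ℤ-Solver.solve-∀

-- Four strategies run in parallel on a fourfold sum.

channel : (ℤ → ℤ → ℤ → ℤ) → ∀ {T} → Vec ℤ (T ℕ.* 3) → Vec ℤ T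
channel δ {zero}  []               = []
-- `suc T * 3` computes to `3 + T * 3`, so a clause consumes the three answers of one round.
channel δ {suc T} (u ∷ v ∷ w ∷ 𝐚) = δ u v w ∷ channel δ 𝐚

module _ {W X Y Z : Set} (w₀ : W) (x₀ : X) (y₀ : Y) (z₀ : Z) where

  -- Adaptivity survives: each strategy is advanced by its own decoded answer once the three queries
  -- of a round are complete.
  interleave : ∀ {T} → Strategy W T → Strategy X T → Strategy Y T → Strategy Z T →
    Strategy ((W × X) × (Y × Z)) (T ℕ.* 3)
  interleave done done done done = done
  interleave (ask a k₁) (ask b k₂) (ask c k₃) (ask d k₄) =
    ask ((a , b) , (y₀ , z₀)) λ u →
    ask ((a , x₀) , (c , z₀)) λ v →
    ask ((w₀ , b) , (c , d)) λ w →
    interleave (k₁ (decode₁ u v w)) (k₂ (decode₂ u v w))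
               (k₃ (decode₃ u v w)) (k₄ (decode₄ u v w))

  module _ {h : (W × X) × (Y × Z) → ℤ} {f₁ : W → ℤ} {f₂ : X → ℤ}
    {f₃ : Y → ℤ} {f₄ : Z → ℤ}
    (f₁-zero : f₁ w₀ ≡ 0ℤ) (f₂-zero : f₂ x₀ ≡ 0ℤ) (f₃-zero : f₃ y₀ ≡ 0ℤ) (f₄-zero : f₄ z₀ ≡ 0ℤ)
    (h-splits : ∀ a b c d → h ((a , b) , (c , d)) ≡ (f₁ a ℤ.+ f₂ b) ℤ.+ (f₃ c ℤ.+ f₄ d)) where

    first-query : ∀ a b → h ((a , b) , (y₀ , z₀)) ≡ f₁ a ℤ.+ f₂ b
    first-query a b = trans (h-splits a b y₀ z₀)
      (+-zeroʳ (f₁ a ℤ.+ f₂ b) (trans (+-zeroʳ (f₃ y₀) f₄-zero) f₃-zero))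

    second-query : ∀ a c → h ((a , x₀) , (c , z₀)) ≡ f₁ a ℤ.+ f₃ c
    second-query a c = trans (h-splits a x₀ c z₀)
      (cong₂ ℤ._+_ (+-zeroʳ (f₁ a) f₂-zero) (+-zeroʳ (f₃ c) f₄-zero))

    third-query : ∀ b c d → h ((w₀ , b) , (c , d)) ≡ f₂ b ℤ.+ (f₃ c ℤ.+ f₄ d)
    third-query b c d = trans (h-splits w₀ b c d)
      (cong (ℤ._+ (f₃ c ℤ.+ f₄ d)) (+-zeroˡ (f₂ b) f₁-zero))

    -- By induction on rounds: as long as the fourth answer is a bit, decoding returns the true
    -- answers, so each strategy continues as if it were run alone.
    interleave-answers : ∀ {T} (s₁ : Strategy W T) (s₂ : Strategy X T)
      (s₃ : Strategy Y T) (s₄ : Strategy Z T) → All Bit (answers s₄ f₄) →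
      let 𝐚 = answers (interleave s₁ s₂ s₃ s₄) h in
        (channel decode₁ 𝐚 ≡ answers s₁ f₁ × channel decode₂ 𝐚 ≡ answers s₂ f₂)
      × (channel decode₃ 𝐚 ≡ answers s₃ f₃ × channel decode₄ 𝐚 ≡ answers s₄ f₄)
    interleave-answers done done done done _ = (refl , refl) , (refl , refl)
    interleave-answers (ask a k₁) (ask b k₂) (ask c k₃) (ask d k₄) (bit ∷ bits)
      rewrite first-query a b | second-query a c | third-query b c d
            | decode₁-correct (f₁ a) (f₂ b) (f₃ c) bit | decode₂-correct (f₁ a) (f₂ b) (f₃ c) bit
            | decode₃-correct (f₁ a) (f₂ b) (f₃ c) bit | decode₄-correct (f₁ a) (f₂ b) (f₃ c) bit
      with interleave-answers (k₁ (f₁ a)) (k₂ (f₂ b)) (k₃ (f₃ c)) (k₄ (f₄ d)) bits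
    ... | (e₁ , e₂) , (e₃ , e₄) =
      (cong (_ ∷_) e₁ , cong (_ ∷_) e₂) , (cong (_ ∷_) e₃ , cong (_ ∷_) e₄)

-- Only the fourth reduction has to be simple. The combined answers are sums, so the result is no
-- longer simple.
four-in-three : ∀ {V₁ V₂ V₃ A B C D T 𝐀 𝐁 𝐂 𝐃} →
  Reduction V₁ A T 𝐀 → Reduction V₂ B T 𝐁 → Reduction V₃ C T 𝐂 → Reduction Bit D T 𝐃 →
  Reduction AnyInt ((A ⊕ B) ⊕ (C ⊕ D)) (T ℕ.* 3) ((𝐀 ⊕ˢ 𝐁) ⊕ˢ (𝐂 ⊕ˢ 𝐃))
four-in-three {A = A} {B} {C} {D} {T} r₁ r₂ r₃ r₄ = record
  { strategy = s
  ; valid    = λ _ _ → All.universal (λ _ → tt) _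
  ; outcome  = λ 𝐚 → weakenK
      -- Decoding needs all four components at once: while one pair ranges over its decompositions,
      -- the other uses the one in its membership proof.
      (λ { h _ eq fab fcd (fa , fb , ia , ib , eab) (fc , fd , ic , id , ecd) e →
        (λ fa fb ia ib eab → proj₁ (channels 𝐚 ia ib ic id e eab ecd eq)) ,
        (λ fc fd ic id ecd → proj₂ (channels 𝐚 ia ib ic id e eab ecd eq)) })
      (outcome-⊕ (outcome-⊕ (outcome r₁ (channel decode₁ 𝐚)) (outcome r₂ (channel decode₂ 𝐚)))
                 (outcome-⊕ (outcome r₃ (channel decode₃ 𝐚)) (outcome r₄ (channel decode₄ 𝐚)))) }
  where
  s : Strategy ((Q A × Q B) × (Q C × Q D)) (T ℕ.* 3)
  s = interleave (zeroQ A) (zeroQ B) (zeroQ C) (zeroQ D)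
        (strategy r₁) (strategy r₂) (strategy r₃) (strategy r₄)

  channels : ∀ 𝐚 {h fa fb fc fd} {fab : Q A × Q B → ℤ} {fcd : Q C × Q D → ℤ} →
    F A fa → F B fb → F C fc → F D fd →
    Splits h fab fcd → Splits fab fa fb → Splits fcd fc fd → answers s h ≡ 𝐚 →
    (answers (strategy r₁) fa ≡ channel decode₁ 𝐚 × answers (strategy r₂) fb ≡ channel decode₂ 𝐚) ×
    (answers (strategy r₃) fc ≡ channel decode₃ 𝐚 × answers (strategy r₄) fd ≡ channel decode₄ 𝐚)
  channels _ ia ib ic id e eab ecd refl =
    let (e₁ , e₂) , (e₃ , e₄) = interleave-answers _ _ _ _
          (F-zero A _ ia) (F-zero B _ ib) (F-zero C _ ic) (F-zero D _ id)
          (λ a b c d → trans (e (a , b) (c , d)) (cong₂ ℤ._+_ (eab a b) (ecd c d)))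
          (strategy r₁) (strategy r₂) (strategy r₃) (strategy r₄) (valid r₄ _ id)
    in (sym e₁ , sym e₂) , (sym e₃ , sym e₄)

-- Adding and removing trivial summands.

add-trivial : ∀ {V} A → Reduction V A 0 (_≡ A ⊕ trivialGame)
add-trivial A = unqueried (record
  { target = A ⊕ trivialGame ; target∈ = refl ; embed = proj₁
  ; restrict = λ f i _ → f , (λ _ → 0ℤ) , i , refl , λ _ _ → sym (ℤ.+-identityʳ _)
  ; determine = λ _ _ _ _ _ _ e q → e (q , tt) })

-- This is the shape left once three of four summands have been solved.
drop-trivial : ∀ {V} A → Reduction V ((trivialGame ⊕ trivialGame) ⊕ (trivialGame ⊕ A)) 0 (_≡ A)
drop-trivial A = unqueried (record
  { target = A ; target∈ = refl ; embed = λ q → (tt , tt) , (tt , q)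
  ; restrict = λ { h (_ , _ , i , (_ , _ , j , k , e') , e) _ → F-resp A (λ q → sym
      (trans (e (tt , tt) (tt , q)) (trans (+-zeroˡ _ (F-zero (trivialGame ⊕ trivialGame) _ i))
        (trans (e' tt q) (+-zeroˡ _ j))))) k }
  ; determine = λ _ _ _ _ _ _ e → λ { ((tt , tt) , (tt , q)) → e q } })

-- Passage from the given reductions and to solutions.

fromIsReduction : ∀ {A T 𝐁} (s : Strategy (Q A) T) → IsSimple A s → IsReduction A s 𝐁 →
  Reduction Bit A T 𝐁
fromIsReduction s simple reduces = record
  { strategy = s ; valid = simple
  ; outcome = λ 𝐚 → let B , B∈ , φ , Φ , Φ-resp , recover = reduces 𝐚 in record
      { target = B ; target∈ = B∈ ; embed = φ
      ; restrict = λ f i e → proj₁ (recover f i e)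
      -- `Φ` respects pointwise equality and undoes restriction, so restriction is injective on
      -- consistent codewords.
      ; determine = λ f g i j e e' f≈g q →
          let p , back = recover f i e ; p' , back' = recover g j e' in
          trans (sym (back q)) (trans (Φ-resp _ _ p p' f≈g q) (back' q)) } }

-- Codewords of the trivial game are 0 at its only query, so two codewords with the same answers
-- have equal restrictions.
solution : ∀ {V A T} (r : Reduction V A T trivialSet) → IsSolution A (strategy r)
solution r f g i j e with outcome r (answers (strategy r) g)
... | record { target∈ = refl ; restrict = res ; determine = det } =
  det f g i j e refl (λ { tt → trans (res f i e) (sym (res g j refl)) })

-- Approximation by powers of four.

size : ℕ → ℕ
size zero    = 1
-- The factor four is written as two doublings so that `halve` applies twice as it stands.
size (suc m) = 2 ℕ.* (2 ℕ.* size m)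

-- A power of four is kept until n exceeds it and is then replaced by the next; at that moment the
-- old one is below n, so the new one is at most 4n.
size-approximates : ∀ n → 1 ≤ n → ∃[ m ] (n ≤ size m × size m ≤ 4 ℕ.* n)
size-approximates (suc zero)    _ = 0 , s≤s z≤n , s≤s z≤n
size-approximates (suc (suc n)) _ with size-approximates (suc n) (s≤s z≤n)
... | m , n≤ , ≤4n with suc (suc n) ℕ.≤? size m
...   | yes n<    = m , n< , ℕ.≤-trans ≤4n (ℕ.*-monoʳ-≤ 4 (ℕ.n≤1+n (suc n)))
...   | no  n≮    = suc m , ℕ.≤-trans step (quadruple n≤) , 4size≤
  where
  size≤ : size m ≤ suc n
  size≤ = ℕ.s≤s⁻¹ (ℕ.≰⇒> n≮)
  four : ∀ k → 4 ℕ.* k ≡ 2 ℕ.* (2 ℕ.* k)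
  four = ℕ-Solver.solve-∀
  quadruple : ∀ {k l} → k ≤ l → 4 ℕ.* k ≤ 2 ℕ.* (2 ℕ.* l)
  quadruple {k} {l} k≤l = subst (4 ℕ.* k ≤_) (four l) (ℕ.*-monoʳ-≤ 4 k≤l)
  step : suc (suc n) ≤ 4 ℕ.* suc n
  step = ℕ.≤-trans (s≤s (ℕ.m≤n+m (suc n) n)) (ℕ.+-monoʳ-≤ (suc n) (ℕ.m≤m+n (suc n) _))
  4size≤ : size (suc m) ≤ 4 ℕ.* suc (suc n)
  4size≤ = subst (_≤ 4 ℕ.* suc (suc n)) (four (size m))
    (ℕ.*-monoʳ-≤ 4 (ℕ.≤-trans size≤ (ℕ.n≤1+n (suc n))))

-- The trivial game pads the halving of a game that already has size 1.
data Bounded (𝐀 : ℕ → GameSet) (N : ℕ) : GameSet where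
  trivial : Bounded 𝐀 N trivialGame
  member  : ∀ {n A} → 1 ≤ n → n ≤ N → 𝐀 n A → Bounded 𝐀 N A

-- Halving, preloading and solving within a budget.

module Schedule
  (𝐀 : ℕ → GameSet) (budget : ℕ → ℕ)
  (budget-mono : ∀ {m n} → m ≤ n → budget m ≤ budget n)
  -- The instance is n ↦ ⌊αn⌋. Lengths within separate budgets add up to at most the budget of the
  -- total size, so below it suffices to count sizes.
  (budget-superadditive : ∀ m n → budget m ℕ.+ budget n ≤ budget (m ℕ.+ n))
  (reduce-one : ∀ A → 𝐀 1 A → Reduction Bit A (budget 1) trivialSet)
  (reduce : ∀ n → 2 ≤ n → ∀ A → 𝐀 n A →
    Reduction Bit A (budget n) (𝐀 ⌈ n /2⌉ ⊕ˢ 𝐀 ⌊ n /2⌋)) where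

  -- The part still to be preloaded stands last, where `four-in-three` expects the simple reduction.
  Preloaded : ℕ → GameSet
  Preloaded zero    = Bounded 𝐀 1
  Preloaded (suc m) = (Preloaded m ⊕ˢ Preloaded m) ⊕ˢ (Preloaded m ⊕ˢ Bounded 𝐀 (size m))

  bit0 : Bit 0ℤ
  bit0 = inj₁ refl

  -- Bounds instead of exact sizes absorb the unequal halves of an odd size. Games of size 1 and the
  -- trivial game gain a trivial summand at no cost; padding gives all cases the same length.
  halve : ∀ {N A} → 1 ≤ N → Bounded 𝐀 (2 ℕ.* N) A →
    Reduction Bit A (budget (2 ℕ.* N)) (Bounded 𝐀 N ⊕ˢ Bounded 𝐀 N)
  halve 1≤N trivial = pad bit0 z≤n
    (weaken (λ { _ refl → _ , _ , trivial , trivial , refl }) (add-trivial trivialGame))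
  halve 1≤N (member {1} {A} _ _ A∈) = pad bit0 z≤n
    (weaken (λ { _ refl → _ , _ , member ℕ.≤-refl 1≤N A∈ , trivial , refl }) (add-trivial A))
  halve {N} 1≤N (member {n@(suc (suc k))} 1≤n n≤2N A∈) = pad bit0 (budget-mono n≤2N)
    (weaken (λ { _ (_ , _ , l , r , refl) →
        _ , _ , member (s≤s z≤n) ⌈n/2⌉≤N l
              , member (s≤s z≤n) (ℕ.≤-trans (ℕ.⌊n/2⌋≤⌈n/2⌉ n) ⌈n/2⌉≤N) r , refl })
      (reduce n (s≤s (s≤s z≤n)) _ A∈))
    where
    half-double : ∀ N → ⌈ 2 ℕ.* N /2⌉ ≡ N
    half-double N = trans (cong (λ M → ⌈ N ℕ.+ M /2⌉) (ℕ.+-identityʳ N)) (sym (ℕ.n≡⌈n+n/2⌉ N))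
    ⌈n/2⌉≤N : ⌈ n /2⌉ ≤ N
    ⌈n/2⌉≤N = subst (⌈ n /2⌉ ≤_) (half-double N) (ℕ.⌈n/2⌉-mono n≤2N)

  1≤size : ∀ m → 1 ≤ size m
  1≤size zero    = ℕ.≤-refl
  1≤size (suc m) = ℕ.*-mono-≤ {1} {2} (s≤s z≤n) (ℕ.*-mono-≤ {1} {2} (s≤s z≤n) (1≤size m))

  -- The 8 is the solution c of 4c = 4 + 2 + 2 + 3c: one halving at size 4s, two at size 2s and
  -- three preloadings at size s.
  cost : ℕ → ℕ
  cost m = budget (8 ℕ.* size m)

  infixl 6 _⊹_

  _⊹_ : ∀ {s t m n} → s ≤ budget m → t ≤ budget n → s ℕ.+ t ≤ budget (m ℕ.+ n)
  p ⊹ q = ℕ.≤-trans (ℕ.+-mono-≤ p q) (budget-superadditive _ _)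

  fits : ∀ {t m n} → t ≤ budget m → m ≡ n → t ≤ budget n
  fits p refl = p

  m+0≤m : ∀ {m} → m ℕ.+ 0 ≤ m
  m+0≤m = ℕ.≤-reflexive (ℕ.+-identityʳ _)

  -- Composition and sums keep the answers in {0, 1}, which later allows this reduction to run as
  -- the fourth one. At size 1 there is nothing to do and the budget is spent on zero queries.
  preload : ∀ m {A} → Bounded 𝐀 (size m) A → Reduction Bit A (cost m) (Preloaded m)
  preload zero    A∈ = wait bit0 (cost 0) A∈
  preload (suc m) A∈ = pad bit0
    (fits (ℕ.≤-refl ⊹ ((ℕ.≤-refl ⊹ ℕ.≤-refl) ⊹ ((ℕ.≤-refl ⊹ ℕ.≤-refl) ⊹ m+0≤m))) (total (size m)))
    (halve (ℕ.*-mono-≤ {1} {2} (s≤s z≤n) (1≤size m)) A∈ ⨟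
     λ { _ (_ , _ , B∈ , C∈ , refl) → halve (1≤size m) B∈ ⊞ halve (1≤size m) C∈ ⨟
     λ { _ (_ , _ , (_ , _ , p , q , refl) , (_ , _ , r , s , refl) , refl) →
       (preload m p ⊞ preload m q) ⊞ (preload m r ⊞ wait bit0 0 s) } })
    where
    total : ∀ s →
      2 ℕ.* (2 ℕ.* s) ℕ.+ (2 ℕ.* s ℕ.+ 2 ℕ.* s ℕ.+ (8 ℕ.* s ℕ.+ 8 ℕ.* s ℕ.+ 8 ℕ.* s)) ≡
      8 ℕ.* (2 ℕ.* (2 ℕ.* s))
    total = ℕ-Solver.solve-∀

  solve : ∀ m {A} → Preloaded m A → Reduction AnyInt A (cost m) trivialSet
  solve zero    trivial              = wait tt (cost 0) refl
  solve zero    (member {1} _ _ A∈)  = pad tt (budget-mono (s≤s z≤n)) (forgetV (reduce-one _ A∈))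
  solve zero    (member {suc (suc _)} _ (s≤s ()) _)
  solve (suc m) (_ , _ , (_ , _ , p , q , refl) , (_ , _ , r , s , refl) , refl) =
    -- The parallel phase takes 3 · 8s and solving the fourth part another 8s, which is 8 · 4s: the
    -- constant reproduces itself.
    pad tt (fits (triple ⊹ ℕ.≤-refl) (total (size m)))
      (four-in-three (solve m p) (solve m q) (solve m r) (preload m s) ⨟
       λ { _ (_ , _ , (_ , _ , refl , refl , refl) , (_ , _ , refl , B∈ , refl) , refl) →
         drop-trivial _ ⨟ λ { _ refl → solve m B∈ } })
    where
    total : ∀ s → (8 ℕ.* s ℕ.+ (8 ℕ.* s ℕ.+ 8 ℕ.* s)) ℕ.+ 8 ℕ.* s ≡ 8 ℕ.* (2 ℕ.* (2 ℕ.* s))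
    total = ℕ-Solver.solve-∀
    triple : cost m ℕ.* 3 ≤ budget (8 ℕ.* size m ℕ.+ (8 ℕ.* size m ℕ.+ 8 ℕ.* size m))
    triple = ℕ.≤-trans (ℕ.≤-reflexive (ℕ.*-comm (cost m) 3)) (ℕ.≤-refl ⊹ (ℕ.≤-refl ⊹ m+0≤m))

  -- The factor 64 is (8 + 8) · 4: preloading and solving each cost 8 times the power of four, which
  -- is at most 4n.
  solve-all : ∀ n → 1 ≤ n → ∀ {A} → 𝐀 n A → Reduction AnyInt A (budget (64 ℕ.* n)) trivialSet
  solve-all n 1≤n A∈ = let m , n≤ , ≤4n = size-approximates n 1≤n in
    pad tt (ℕ.≤-trans (ℕ.≤-refl ⊹ ℕ.≤-refl) (budget-mono (total (size m) n ≤4n)))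
      (forgetV (preload m (member 1≤n n≤ A∈)) ⨟ λ _ → solve m)
    where
    total : ∀ s n → s ≤ 4 ℕ.* n → 8 ℕ.* s ℕ.+ 8 ℕ.* s ≤ 64 ℕ.* n
    total s n s≤ = begin
      8 ℕ.* s ℕ.+ 8 ℕ.* s     ≡⟨ ℕ.*-distribʳ-+ s 8 8 ⟨
      16 ℕ.* s                ≤⟨ ℕ.*-monoʳ-≤ 16 s≤ ⟩
      16 ℕ.* (4 ℕ.* n)        ≡⟨ ℕ.*-assoc 16 4 n ⟨
      64 ℕ.* n                ∎
      where open ℕ.≤-Reasoning

-- Rational bounds and integer floors.

toℚᵘ-/1 : ∀ i → toℚᵘ (i / 1) ℚᵘ.≃ ℚᵘ.mkℚᵘ i 0
toℚᵘ-/1 i = ℚ.toℚᵘ-fromℚᵘ (ℚᵘ.mkℚᵘ i 0)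

/1-homo-* : ∀ m n → (+ m / 1) * (+ n / 1) ≡ + (m ℕ.* n) / 1
/1-homo-* m n = ℚ.toℚᵘ-injective (begin
  toℚᵘ ((+ m / 1) * (+ n / 1))              ≈⟨ ℚ.toℚᵘ-homo-* (+ m / 1) (+ n / 1) ⟩
  toℚᵘ (+ m / 1) ℚᵘ.* toℚᵘ (+ n / 1)        ≈⟨ ℚᵘ.*-cong (toℚᵘ-/1 (+ m)) (toℚᵘ-/1 (+ n)) ⟩
  ℚᵘ.mkℚᵘ (+ m ℤ.* + n) 0                   ≡⟨ cong (λ i → ℚᵘ.mkℚᵘ i 0) (sym (ℤ.pos-* m n)) ⟩
  ℚᵘ.mkℚᵘ (+ (m ℕ.* n)) 0                   ≈⟨ toℚᵘ-/1 (+ (m ℕ.* n)) ⟨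
  toℚᵘ (+ (m ℕ.* n) / 1)                    ∎)
  where open ℚᵘ.≃-Reasoning

scaled-bound : ∀ C α n → α * (+ (C ℕ.* n) / 1) ≡ (+ C / 1) * α * (+ n / 1)
scaled-bound C α n = begin
  α * (+ (C ℕ.* n) / 1)          ≡⟨ cong (α *_) (/1-homo-* C n) ⟨
  α * ((+ C / 1) * (+ n / 1))    ≡⟨ ℚ.*-assoc α (+ C / 1) (+ n / 1) ⟨
  α * (+ C / 1) * (+ n / 1)      ≡⟨ cong (_* (+ n / 1)) (ℚ.*-comm α (+ C / 1)) ⟩
  (+ C / 1) * α * (+ n / 1)      ∎
  where open ≡-Reasoning

module _ (p d : ℕ) .(coprime : Coprime p (suc d)) where

  α : ℚ
  α = mkℚ (+ p) d coprime

  -- With α = p / (d + 1) this is ⌊αn⌋; lengths are integers, so nothing is lost by bounding them by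
  -- it.
  floorα* : ℕ → ℕ
  floorα* n = p ℕ.* n ℕ./ suc d

  floorα*-mono : ∀ {m n} → m ≤ n → floorα* m ≤ floorα* n
  floorα*-mono m≤n = ℕ./-monoˡ-≤ (suc d) (ℕ.*-monoʳ-≤ p m≤n)

  floorα*-≤ : ∀ n → floorα* n ℕ.* suc d ≤ p ℕ.* n
  floorα*-≤ n = ℕ.m/n*n≤m (p ℕ.* n) (suc d)

  -- Together with `floorα*-≤` this characterises the floor: t ≤ ⌊αn⌋ exactly when t(d + 1) ≤ pn.
  ≤-floorα* : ∀ {t n} → t ℕ.* suc d ≤ p ℕ.* n → t ≤ floorα* n
  ≤-floorα* {t} t≤ = subst (_≤ _) (ℕ.m*n/n≡m t (suc d)) (ℕ./-monoˡ-≤ (suc d) t≤)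

  floorα*-superadditive : ∀ m n → floorα* m ℕ.+ floorα* n ≤ floorα* (m ℕ.+ n)
  floorα*-superadditive m n = ≤-floorα* (begin
    (floorα* m ℕ.+ floorα* n) ℕ.* suc d               ≡⟨ ℕ.*-distribʳ-+ (suc d) (floorα* m) _ ⟩
    floorα* m ℕ.* suc d ℕ.+ floorα* n ℕ.* suc d       ≤⟨ ℕ.+-mono-≤ (floorα*-≤ m) (floorα*-≤ n) ⟩
    p ℕ.* m ℕ.+ p ℕ.* n                               ≡⟨ ℕ.*-distribˡ-+ p m n ⟨
    p ℕ.* (m ℕ.+ n)                                   ∎)
    where open ℕ.≤-Reasoning

  toℚᵘ-α* : ∀ n → toℚᵘ (α * (+ n / 1)) ℚᵘ.≃ ℚᵘ.mkℚᵘ (+ p) d ℚᵘ.* ℚᵘ.mkℚᵘ (+ n) 0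
  toℚᵘ-α* n = ℚᵘ.≃-trans (ℚ.toℚᵘ-homo-* α (+ n / 1))
    (ℚᵘ.*-cong {toℚᵘ α} ℚᵘ.≃-refl (toℚᵘ-/1 (+ n)))

  -- These are the two sides of t ≤ αn after cross-multiplication, in the form in which unnormalised
  -- rationals present them.
  cleared : ∀ t n → (+ t ℤ.* + (suc d ℕ.* 1) ≡ + (t ℕ.* suc d)) ×
    ((+ p ℤ.* + n) ℤ.* + 1 ≡ + (p ℕ.* n))
  cleared t n =
    trans (sym (ℤ.pos-* t _)) (cong (λ k → + (t ℕ.* k)) (ℕ.*-identityʳ (suc d))) ,
    trans (ℤ.*-identityʳ _) (sym (ℤ.pos-* p n))

  ≤α*⇒≤floor : ∀ {t n} → + t / 1 ℚ.≤ α * (+ n / 1) → t ≤ floorα* n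
  ≤α*⇒≤floor {t} {n} t≤
    with ℚᵘ.≤-respʳ-≃ (toℚᵘ-α* n) (ℚᵘ.≤-respˡ-≃ (toℚᵘ-/1 (+ t)) (ℚ.toℚᵘ-mono-≤ t≤))
  ... | ℚᵘ.*≤* t≤′ = ≤-floorα* (ℤ.drop‿+≤+
    (subst₂ ℤ._≤_ (proj₁ (cleared t n)) (proj₂ (cleared t n)) t≤′))

  floor≤α* : ∀ n → + floorα* n / 1 ℚ.≤ α * (+ n / 1)
  floor≤α* n = ℚ.toℚᵘ-cancel-≤
    (ℚᵘ.≤-respʳ-≃ (ℚᵘ.≃-sym (toℚᵘ-α* n)) (ℚᵘ.≤-respˡ-≃ (ℚᵘ.≃-sym (toℚᵘ-/1 (+ floorα* n)))
      (ℚᵘ.*≤* (subst₂ ℤ._≤_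
        (sym (proj₁ (cleared (floorα* n) n))) (sym (proj₂ (cleared (floorα* n) n)))
        (ℤ.+≤+ (floorα*-≤ n))))))

  fromSimpleReducesWithin : ∀ n {A 𝐁} → SimpleReducesWithin A (α * (+ n / 1)) 𝐁 →
    Reduction Bit A (floorα* n) 𝐁
  fromSimpleReducesWithin n (T , T≤ , s , simple , reduces) =
    pad (inj₁ refl) (≤α*⇒≤floor T≤) (fromIsReduction s simple reduces)

theorem4 : ∃[ C ] ((α : ℚ) → Positive α → (𝐀 : ℕ → GameSet) →
    (∀ A → 𝐀 1 A → SimpleReducesWithin A α trivialSet) →
    (∀ n → 2 ≤ n → ∀ A → 𝐀 n A →
    SimpleReducesWithin A (α * ((+ n) / 1)) (𝐀 ⌈ n /2⌉ ⊕ˢ 𝐀 ⌊ n /2⌋)) →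
    ∀ n → 1 ≤ n → ∀ A → 𝐀 n A →
    SolvableWithin A (((+ C) / 1) * α * ((+ n) / 1)))
-- Positivity of α excludes a negative numerator, so the single pattern is exhaustive.
theorem4 = 64 , λ { α@(mkℚ (+ p) d coprime) _ 𝐀 one step n 1≤n A A∈ →
  let open Schedule 𝐀 (floorα* p d coprime) (floorα*-mono p d coprime)
        (floorα*-superadditive p d coprime)
        (λ B B∈ → fromSimpleReducesWithin p d coprime 1
          -- The bound α at size 1 is rewritten as α · 1 to match the other sizes.
          (subst (λ β → SimpleReducesWithin B β trivialSet) (sym (ℚ.*-identityʳ α)) (one B B∈)))
        (λ k 2≤k B B∈ → fromSimpleReducesWithin p d coprime k (step k 2≤k B B∈))
      r = solve-all n 1≤n A∈
  in floorα* p d coprime (64 ℕ.* n)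
   , subst (+ floorα* p d coprime (64 ℕ.* n) / 1 ℚ.≤_) (scaled-bound 64 α n)
       (floor≤α* p d coprime (64 ℕ.* n))
   , strategy r , solution r }
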